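{- Up to isomorphism, the Paley graph $QR_{13}$ is the only $3$-non-compliant graph on $13$ vertices.
   Context: All graphs are finite, simple and undirected; $\overline{G}$ denotes the complement of $G$. A minor of $G$ is a graph obtained from $G$ by a sequence of vertex deletions, edge deletions and edge contractions (contraction identifies the endpoints of an edge and removes loops and multiple edges). $\Delta(H)$ is the maximum degree of $H$. For an integer $k\ge 1$, a graph $G$ on $n$ vertices is $k$-compliant if $G$ or $\overline{G}$ has a minor $H$ with $\Delta(H)\ge n-k$; otherwise $G$ is $k$-non-compliant. The Paley graph $QR_{13}$ has vertex set $\mathbb{Z}/13\mathbb{Z}$, with $x\ne y$ adjacent iff $x-y$ is a nonzero quadratic residue modulo $13$. -}

module Defs where

open import Data.Bool using (Bool; true; false; _∧_; _∨_; not; if_then_else_)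
open import Data.Bool.Properties using (∨-comm)
open import Data.Nat using (ℕ; zero; suc; _+_; _*_; _∸_; _≤_; _⊔_; _%_)
import Data.Nat as ℕ
open import Data.Fin using (Fin; toℕ; punchIn)
open import Data.Fin.Properties using (_≟_)
open import Data.List using (List; foldr; map; filter; length; allFin)
open import Data.Bool.ListAction using (any)
open import Data.Product using (Σ; Σ-syntax; _×_; _,_)
open import Data.Sum using (_⊎_)
open import Relation.Nullary using (¬_; yes; no)
open import Relation.Nullary.Decidable using (⌊_⌋)
open import Relation.Binary.PropositionalEquality using (_≡_; refl; sym; cong₂)
open import Function.Bundles using (_↔_; Inverse)

record Graph (n : ℕ) : Set where
  field
    adj    : Fin n → Fin n → Bool
    adj-sym    : ∀ x y → adj x y ≡ adj y x
    adj-irrefl : ∀ x → adj x x ≡ false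
open Graph public

_==_ : ∀ {n} → Fin n → Fin n → Bool
x == y = ⌊ x ≟ y ⌋

private
  ==-sym : ∀ {n} (x y : Fin n) → (x == y) ≡ (y == x)
  ==-sym x y with x ≟ y | y ≟ x
  ... | yes _ | yes _ = refl
  ... | no _  | no _  = refl
  ... | yes p | no q  = Relation.Nullary.contradiction (sym p) q
    where import Relation.Nullary
  ... | no p  | yes q = Relation.Nullary.contradiction (sym q) p
    where import Relation.Nullary

  ==-refl : ∀ {n} (x : Fin n) → (x == x) ≡ true
  ==-refl x with x ≟ x
  ... | yes _ = refl
  ... | no q  = Relation.Nullary.contradiction refl q
    where import Relation.Nullary

-- Simple graph generated by a relation r: x ~ y iff x ≠ y and (r x y or r y x).
-- (If r is already symmetric and irreflexive, this is exactly r.)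
mkGraph : ∀ {n} → (Fin n → Fin n → Bool) → Graph n
mkGraph r = record
  { adj = λ x y → not (x == y) ∧ (r x y ∨ r y x)
  ; adj-sym = λ x y → cong₂ (λ a b → not a ∧ b) (==-sym x y) (∨-comm (r x y) (r y x))
  ; adj-irrefl = λ x → cong₂ (λ a b → not a ∧ b) (==-refl x) (refl {x = r x x ∨ r x x})
  }

complement : ∀ {n} → Graph n → Graph n
complement G = mkGraph (λ x y → not (adj G x y))

-- Degree and maximum degree (Δ of the graph with no vertices is 0).
degree : ∀ {n} → Graph n → Fin n → ℕ
degree G x = length (filter (λ y → adj G x y ≟b true) (allFin _))
  where
    open import Data.Bool.Properties renaming (_≟_ to _≟b_)

maxDegree : ∀ {n} → Graph n → ℕ
maxDegree G = foldr _⊔_ 0 (map (degree G) (allFin _))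

deleteVertex : ∀ {n} → Graph (suc n) → Fin (suc n) → Graph n
deleteVertex G v = mkGraph (λ x y → adj G (punchIn v x) (punchIn v y))

deleteEdge : ∀ {n} → Graph n → Fin n → Fin n → Graph n
deleteEdge G u v =
  mkGraph (λ x y → adj G x y ∧ not ((x == u ∧ y == v) ∨ (x == v ∧ y == u)))

-- Contract the edge between v and (punchIn v u): vertex v is merged into
-- the vertex punchIn v u; the merged vertex is u in the new vertex set
-- (the remaining vertices of G other than v), loops/multi-edges removed.
contractEdge : ∀ {n} → Graph (suc n) → Fin (suc n) → Fin n → Graph n
contractEdge G v u = mkGraph (λ x y →
  adj G (punchIn v x) (punchIn v y) ∨ (x == u ∧ adj G v (punchIn v y)))

data _≼_ : ∀ {m n} → Graph m → Graph n → Set where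
  ≼-refl : ∀ {n} {G : Graph n} → G ≼ G
  ≼-delV : ∀ {m n} {H : Graph m} {G : Graph (suc n)} (v : Fin (suc n)) →
           H ≼ deleteVertex G v → H ≼ G
  ≼-delE : ∀ {m n} {H : Graph m} {G : Graph n} (u v : Fin n) →
           adj G u v ≡ true → H ≼ deleteEdge G u v → H ≼ G
  ≼-contr : ∀ {m n} {H : Graph m} {G : Graph (suc n)} (v : Fin (suc n)) (u : Fin n) →
           adj G v (punchIn v u) ≡ true → H ≼ contractEdge G v u → H ≼ G

Compliant : ∀ {n} → ℕ → Graph n → Set
Compliant {n} k G =
  Σ[ m ∈ ℕ ] Σ[ H ∈ Graph m ] ((H ≼ G ⊎ H ≼ complement G) × (n ∸ k ≤ maxDegree H))

NonCompliant : ∀ {n} → ℕ → Graph n → Set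
NonCompliant k G = ¬ Compliant k G

_≅_ : ∀ {n} → Graph n → Graph n → Set
_≅_ {n} G H = Σ[ f ∈ Fin n ↔ Fin n ]
  (∀ x y → adj G x y ≡ adj H (Inverse.to f x) (Inverse.to f y))

isNonzeroQR13 : ℕ → Bool
isNonzeroQR13 d = not (d ℕ.≡ᵇ 0) ∧ any (λ z → ((toℕ z * toℕ z) % 13) ℕ.≡ᵇ d) (allFin 13)

QR13 : Graph 13
QR13 = mkGraph (λ x y → isNonzeroQR13 ((toℕ x + 13 ∸ toℕ y) % 13))

{-# OPTIONS --safe #-}
-- Call a pair of vertices linked by c = true if adjacent and by c = false if not. If no minor of G or of its complement
-- has a vertex of degree 10, then the vertices of every path with three vertices in one colour have a common
-- neighbour in the other colour: otherwise contracting the path yields a vertex adjacent to all 10 remaining ones.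
-- Playing both colours against each other, any two vertices linked by one colour have at least three common
-- neighbours in the other. For the neighbours A and the non-neighbours B of a vertex, counting the edges and the
-- non-edges between A and B gives |A||B| ≥ 3|B| + 3|A| = 36, whereas |A| + |B| = 12. Hence |A| = |B| = 6, all counts
-- are exact, and G is strongly regular with parameters (13,6,2,3). An exhaustive search over the adjacency matrices
-- with two normalised rows shows that such a graph is QR13.
-- Conversely, the branch set of a vertex of degree 10 in a minor of QR13 has at most three vertices and dominates all
-- but at most three of the 13; a finite check excludes this. The complement is covered since QR13 is self-complementary.
module Submission where

open import Defs
open import Data.Bool using (Bool; true; false; _∧_; _∨_; not; if_then_else_)
import Data.Bool.Properties as Bool
open import Data.Empty using (⊥)
open import Data.Nat using (ℕ; zero; suc; _+_; _*_; _∸_; _≤_; _⊔_; _≡ᵇ_; z≤n; s≤s; _≤?_)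
import Data.Nat as ℕ
open import Data.Nat.DivMod using (_mod_)
open import Data.Nat.Properties using
  ( ≤-refl; ≤-reflexive; ≤-trans; ≤-antisym; n<1+n; suc-injective; +-suc; +-comm; +-identityʳ
  ; +-mono-≤; +-monoʳ-≤; +-cancelˡ-≡; +-cancelʳ-≡; +-cancelˡ-≤; +-cancelʳ-≤; m≤m+n; m+n∸m≡n
  ; m≤m⊔n; m≤n⊔m; ⊔-sel; module ≤-Reasoning )
open import Data.Nat.Solver using (module +-*-Solver)
open import Data.Fin using (Fin; zero; suc; toℕ; fromℕ<; punchIn; punchOut)
open import Data.Fin.Properties using
  ( _≟_; all?; any?; toℕ-fromℕ<; <⇒notInjective; punchOut-injective; punchIn-injective
  ; punchInᵢ≢i; punchIn-punchOut )
open import Data.List using (List; []; _∷_; _++_; map; length; allFin; replicate; filter; foldr)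
open import Data.List.Properties using
  (map-++; map-cong; map-∘; length-map; length-++; length-tabulate; ++-assoc; ++-identityʳ)
open import Data.List.Membership.Propositional using (_∈_; _∉_)
open import Data.List.Membership.Propositional.Properties using
  (∈-∃++; ∈-allFin; ∈-map⁺; ∈-map⁻; ∈-++⁻; ∈-++⁺ˡ; ∈-++⁺ʳ)
open import Data.List.Relation.Binary.Permutation.Propositional as ↭ using
  (_↭_; prep; ↭-refl; ↭-sym; ↭-trans; ↭-reflexive; ↭⇒↭ₛ)
open import Data.List.Relation.Binary.Permutation.Propositional.Properties using
  (shift; ++⁺; ↭-length; All-resp-↭; ∈-resp-↭)
open import Data.List.Relation.Binary.Subset.Propositional using (_⊆_)
open import Data.List.Relation.Unary.All as All using (All; []; _∷_)
import Data.List.Relation.Unary.All.Properties as All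
open import Data.List.Relation.Unary.AllPairs using ([]; _∷_)
open import Data.List.Relation.Unary.Any using (here; there)
open import Data.List.Relation.Unary.Unique.Propositional using (Unique)
open import Data.List.Relation.Unary.Unique.Propositional.Properties using (allFin⁺; map⁺)
open import Data.Product using (∃; ∃₂; Σ; Σ-syntax; _×_; _,_; proj₁; proj₂)
open import Data.Sum as Sum using (_⊎_; inj₁; inj₂)
open import Data.Vec as Vec using (Vec; []; _∷_)
open import Function using (_∘_; Injective; Inverse; mk↔ₛ′)
open import Relation.Binary.PropositionalEquality
open import Relation.Nullary using (¬_; Dec; yes; no; contradiction)
open import Relation.Nullary.Decidable using (from-yes; _×-dec_; _→-dec_; ¬?)

-- Counting

-- The adjacency of one vertex with all vertices, along a fixed enumeration.
Row : Set
Row = List Bool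

index : ℕ → Row → Bool
index _       []      = false
index zero    (b ∷ _) = b
index (suc k) (_ ∷ r) = index k r

weight : Row → ℕ
weight []          = 0
weight (true  ∷ r) = suc (weight r)
weight (false ∷ r) = weight r

common : Row → Row → ℕ
common (true  ∷ r) (true  ∷ s) = suc (common r s)
common (true  ∷ r) (false ∷ s) = common r s
common (false ∷ r) (_     ∷ s) = common r s
common _           _           = 0

∧-true : ∀ {a b} → a ∧ b ≡ true → a ≡ true × b ≡ true
∧-true {true} {true} refl = refl , refl

∨-true : ∀ {a b} → a ∨ b ≡ true → a ≡ true ⊎ b ≡ true
∨-true {true}  _ = inj₁ refl
∨-true {false} e = inj₂ e

count : ∀ {A : Set} → (A → Bool) → List A → ℕ
count p xs = weight (map p xs)

weight-++ : ∀ r s → weight (r ++ s) ≡ weight r + weight s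
weight-++ []          s = refl
weight-++ (true  ∷ r) s = cong suc (weight-++ r s)
weight-++ (false ∷ r) s = weight-++ r s

common-map : ∀ {A : Set} (f g : A → Bool) xs → common (map f xs) (map g xs) ≡ count (λ x → f x ∧ g x) xs
common-map f g []       = refl
common-map f g (x ∷ xs) with f x | g x
... | true  | true  = cong suc (common-map f g xs)
... | true  | false = common-map f g xs
... | false | true  = common-map f g xs
... | false | false = common-map f g xs

index-map : ∀ {A : Set} (f : A → Bool) xs y zs → index (length xs) (map f (xs ++ y ∷ zs)) ≡ f y
index-map f []       y zs = refl
index-map f (x ∷ xs) y zs = index-map f xs y zs

count-++ : ∀ {A : Set} (p : A → Bool) xs ys → count p (xs ++ ys) ≡ count p xs + count p ys
count-++ p xs ys = trans (cong weight (map-++ p xs ys)) (weight-++ (map p xs) (map p ys))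

count-∷ : ∀ {A : Set} (p : A → Bool) x xs → count p (x ∷ xs) ≡ weight (p x ∷ []) + count p xs
count-∷ p x xs = weight-++ (p x ∷ []) (map p xs)

count-↭ : ∀ {A : Set} (p : A → Bool) {xs ys} → xs ↭ ys → count p xs ≡ count p ys
count-↭ p ↭.refl      = refl
count-↭ p (↭.prep x xs↭ys) with p x
... | true  = cong suc (count-↭ p xs↭ys)
... | false = count-↭ p xs↭ys
count-↭ p (↭.swap x y xs↭ys) with p x | p y
... | true  | true  = cong (2 +_) (count-↭ p xs↭ys)
... | true  | false = cong suc (count-↭ p xs↭ys)
... | false | true  = cong suc (count-↭ p xs↭ys)
... | false | false = count-↭ p xs↭ys
count-↭ p (↭.trans xs↭ys ys↭zs) = trans (count-↭ p xs↭ys) (count-↭ p ys↭zs)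

count-all : ∀ {A : Set} {p : A → Bool} {xs} → All (λ x → p x ≡ true) xs → count p xs ≡ length xs
count-all []                = refl
count-all (px ∷ pxs) rewrite px = cong suc (count-all pxs)

count-none : ∀ {A : Set} {p : A → Bool} {xs} → All (λ x → p x ≡ false) xs → count p xs ≡ 0
count-none []               = refl
count-none (px ∷ pxs) rewrite px = count-none pxs

count-cong : ∀ {A : Set} {p q : A → Bool} {xs} → All (λ x → p x ≡ q x) xs → count p xs ≡ count q xs
count-cong []            = refl
count-cong {p = p} {q} {x ∷ xs} (e ∷ es) rewrite count-∷ p x xs | count-∷ q x xs | e | count-cong es = refl

split : ∀ {A : Set} (p : A → Bool) xs →
        ∃₂ λ ys zs → xs ↭ ys ++ zs × All (λ x → p x ≡ true) ys × All (λ x → p x ≡ false) zs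
split p []       = [] , [] , ↭-refl , [] , []
split p (x ∷ xs) with p x in eq | split p xs
... | true  | ys , zs , xs↭ , pys , pzs = x ∷ ys , zs , prep x xs↭ , eq ∷ pys , pzs
... | false | ys , zs , xs↭ , pys , pzs =
  ys , x ∷ zs , ↭-trans (prep x xs↭) (↭-sym (shift x ys zs)) , pys , eq ∷ pzs

-- Each element of `ys` is moved to the front of `xs` and removed; as `ys` has no repetitions, its
-- other elements remain in the shortened list.
length≤count : ∀ {A : Set} (p : A → Bool) {ys xs} → Unique ys → All (_∈ xs) ys →
               All (λ y → p y ≡ true) ys → length ys ≤ count p xs
length≤count p []         _           _          = z≤n
length≤count p {y ∷ ys} (y∉ ∷ u) (y∈ ∷ ys∈) (py ∷ pys) with ∈-∃++ y∈
... | as , bs , refl = ≤-trans (s≤s (length≤count p u (All.zipWith elsewhere (y∉ , ys∈)) pys))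
  (≤-reflexive (trans (sym (cong (λ b → weight (b ∷ []) + count p (as ++ bs)) py))
                        (trans (sym (count-∷ p y _)) (sym (count-↭ p (shift y as bs))))))
  where
  elsewhere : ∀ {z} → y ≢ z × z ∈ as ++ y ∷ bs → z ∈ as ++ bs
  elsewhere (y≢z , z∈) with ∈-++⁻ as z∈
  ... | inj₁ z∈as         = ∈-++⁺ˡ z∈as
  ... | inj₂ (here z≡y)   = contradiction (sym z≡y) y≢z
  ... | inj₂ (there z∈bs) = ∈-++⁺ʳ as z∈bs

∑ : ∀ {A : Set} → (A → ℕ) → List A → ℕ
∑ f []       = 0
∑ f (x ∷ xs) = f x + ∑ f xs

∑-count-swap : ∀ {A B : Set} (r : A → B → Bool) xs ys →
               ∑ (λ x → count (r x) ys) xs ≡ ∑ (λ y → count (λ x → r x y) xs) ys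
∑-count-swap r []       []       = refl
∑-count-swap r []       (y ∷ ys) = ∑-count-swap r [] ys
∑-count-swap r (x ∷ xs) ys rewrite ∑-count-swap r xs ys = step ys
  where
  open +-*-Solver
  step : ∀ ys → count (r x) ys + ∑ (λ y → count (λ x → r x y) xs) ys ≡ ∑ (λ y → count (λ x → r x y) (x ∷ xs)) ys
  step []       = refl
  step (y ∷ ys) rewrite count-∷ (r x) y ys | count-∷ (λ x → r x y) x xs | sym (step ys) =
    solve 4 (λ a b c d → (a :+ b) :+ (c :+ d) := (a :+ c) :+ (b :+ d)) refl
      (weight (r x y ∷ [])) (count (r x) ys) _ _

∑-complementary : ∀ {A : Set} (f g : A → ℕ) n xs → All (λ x → f x + g x ≡ n) xs →
                  ∑ f xs + ∑ g xs ≡ length xs * n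
∑-complementary f g n []       []       = refl
∑-complementary f g n (x ∷ xs) (e ∷ es) rewrite sym (∑-complementary f g n xs es) | sym e =
  solve 4 (λ a b c d → (a :+ b) :+ (c :+ d) := (a :+ c) :+ (b :+ d)) refl (f x) (∑ f xs) (g x) (∑ g xs)
  where open +-*-Solver

∑-lower : ∀ {A : Set} (f : A → ℕ) {k} xs → All (λ x → k ≤ f x) xs → length xs * k ≤ ∑ f xs
∑-lower f []       []       = z≤n
∑-lower f (x ∷ xs) (p ∷ ps) = +-mono-≤ p (∑-lower f xs ps)

-- A term above `k` would push the sum over its bound, since the other terms sum to at least their
-- share. This makes the counts exact once the double count is tight.
∑-tight : ∀ {A : Set} (f : A → ℕ) {k} xs → All (λ x → k ≤ f x) xs → ∑ f xs ≤ length xs * k → All (λ x → f x ≡ k) xs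
∑-tight f             []       []       _ = []
∑-tight f {k} (x ∷ xs) (p ∷ ps) le =
  ≤-antisym (+-cancelʳ-≤′ (≤-trans (+-monoʳ-≤ (f x) (∑-lower f xs ps)) le)) p ∷
  ∑-tight f xs ps (+-cancelˡ-≤ k _ _ (≤-trans (+-mono-≤ p ≤-refl) le))
  where
  +-cancelʳ-≤′ : f x + length xs * k ≤ k + length xs * k → f x ≤ k
  +-cancelʳ-≤′ = +-cancelʳ-≤ (length xs * k) (f x) k

count-complementary : ∀ {A : Set} {p q : A → Bool} {xs} → All (λ x → q x ≡ not (p x)) xs →
                      count p xs + count q xs ≡ length xs
count-complementary []       = refl
count-complementary {p = p} {q} {x ∷ xs} (e ∷ es) rewrite e with p x
... | true  = cong suc (count-complementary es)
... | false = trans (+-suc _ _) (cong suc (count-complementary es))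

-- Search through adjacency matrices

-- Does p hold for all rows of length m and weight w?
every : ℕ → ℕ → (Row → Bool) → Bool
every zero    zero    p = p []
-- Vacuous: no row of length 0 has positive weight.
every zero    (suc w) p = true
every (suc m) zero    p = every m zero (p ∘ (false ∷_))
every (suc m) (suc w) p = every m w (p ∘ (true ∷_)) ∧ every m (suc w) (p ∘ (false ∷_))

-- The codegree condition for parameters (13,6,2,3): `s` is the candidate row, and the first
-- argument holds its adjacencies to the vertices of the earlier rows.
compatible : Row → List Row → Row → Bool
compatible (b ∷ bs) (r ∷ rs) s = (common r s ≡ᵇ (if b then 2 else 3)) ∧ compatible bs rs s
compatible _        _        s = true

some : (ℕ → Row → Bool) → ℕ → List Row → Bool
some p k []       = false
some p k (r ∷ rs) = p k r ∨ some p (suc k) rs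

-- Entry d says whether d + 1 is a quadratic residue modulo 13.
residues : Row
residues = true ∷ false ∷ true ∷ true ∷ false ∷ false ∷ false ∷ false ∷ true ∷ true ∷ false ∷ true ∷ []

matches : Row → List ℕ → Row → Bool
matches _        []       r = true
matches []       (_ ∷ _)  r = false
matches (b ∷ bs) (g ∷ gs) r = (if index g r then b else not b) ∧ matches bs gs r

-- Can the vertices at the positions gs be extended by j further ones to a copy of an interval of QR13?
-- New vertices are put in front, so entry j of gs is at distance j + 1 from the vertex added next.
embeds : List Row → ℕ → List ℕ → Bool
embeds M zero    gs = true
embeds M (suc j) gs = some (λ k r → matches residues gs r ∧ embeds M j (k ∷ gs)) 0 M

-- Do all strongly regular completions of the given initial rows by m further rows contain QR13?
-- Symmetry forces the part of a new row before the diagonal, and regularity the weight of the rest.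
search : ℕ → List Row → Bool
search zero    rows = embeds rows 13 []
search (suc m) rows = every m (6 ∸ weight column) λ tail →
  not (compatible column rows (column ++ false ∷ tail)) ∨ search m (rows ++ (column ++ false ∷ tail) ∷ [])
  where column = map (index (length rows)) rows

-- The rows of v and of a neighbour a of v, the other vertices being ordered as N(v) ∩ N(a), N(v) ∖ N(a),
-- N(a) ∖ N(v) and the rest.
first-row second-row : Row
first-row  = false ∷ true ∷ (replicate 2 true ++ replicate 3 true) ++ (replicate 3 false ++ replicate 3 false)
second-row = true ∷ false ∷ (replicate 2 true ++ replicate 3 false) ++ (replicate 3 true ++ replicate 3 false)

abstract
  -- The exhaustive search runs here, by evaluation; `abstract` prevents it from being unfolded
  -- again.
  search-succeeds : search 11 (first-row ∷ second-row ∷ []) ≡ true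
  search-succeeds = refl

-- Soundness of the search

every-sound : ∀ p r → every (length r) (weight r) p ≡ true → p r ≡ true
every-sound p []          e = e
every-sound p (true  ∷ r) e = every-sound (p ∘ (true ∷_)) r (proj₁ (∧-true e))
-- `every` reduces only once the weight is known to be zero or a successor.
every-sound p (false ∷ r) e with weight r in eq
... | zero  = every-sound (p ∘ (false ∷_)) r (trans (cong (λ w → every (length r) w _) eq) e)
... | suc w = every-sound (p ∘ (false ∷_)) r (trans (cong (λ w → every (length r) w _) eq) (proj₂ (∧-true {every (length r) w _} e)))

-- An interval of QR13: two entries at distance `d` are adjacent exactly if `d` is a residue, which
-- `residues` stores at index `d` minus one. The description is valid up to length 13.
data Paley {V : Set} (adj : V → V → Bool) : ∀ {k} → Vec V k → Set where
  []  : Paley adj []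
  _∷_ : ∀ {k x} {xs : Vec V k} → (∀ j → adj x (Vec.lookup xs j) ≡ index (toℕ j) residues) →
        Paley adj xs → Paley adj (x ∷ xs)

module Order {V : Set} (adj : V → V → Bool) (adj-sym : ∀ x y → adj x y ≡ adj y x)
             (adj-irrefl : ∀ x → adj x x ≡ false) (L : List V) where

  row : V → Row
  row x = map (adj x) L

  Located : ℕ → V → Set
  Located k x = ∀ y → index k (row y) ≡ adj y x

  data LocatedAll : ∀ {k} → List ℕ → Vec V k → Set where
    []  : LocatedAll [] []
    _∷_ : ∀ {g gs k x} {xs : Vec V k} → Located g x → LocatedAll gs xs → LocatedAll (g ∷ gs) (x ∷ xs)

  matches-sound : ∀ bs {gs k x} {xs : Vec V k} → LocatedAll gs xs → matches bs gs (row x) ≡ true →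
                  ∀ j → adj x (Vec.lookup xs j) ≡ index (toℕ j) bs
  matches-sound (b ∷ bs) (l ∷ ls) e zero    = trans (sym (l _)) (agree (proj₁ (∧-true e)))
    where
    agree : ∀ {b c} → (if c then b else not b) ≡ true → c ≡ b
    agree {true}  {true}  _ = refl
    agree {false} {false} _ = refl
  matches-sound (b ∷ bs) {gs = g ∷ _} {x = x} (l ∷ ls) e (suc j) =
    matches-sound bs ls (proj₂ (∧-true {if index g (row x) then b else not b} e)) j

  -- `xs` is the part of `L` already scanned, so its length is the position that `some` has reached.
  some-sound : ∀ p xs zs → xs ++ zs ≡ L → some p (length xs) (map row zs) ≡ true →
               ∃ λ k → ∃ λ x → Located k x × p k (row x) ≡ true
  some-sound p xs (z ∷ zs) refl e with ∨-true e
  ... | inj₁ e₁ = length xs , z , (λ y → index-map (adj y) xs z zs) , e₁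
  ... | inj₂ e₂ = some-sound p (xs ++ z ∷ []) zs (++-assoc xs (z ∷ []) zs)
                    (trans (cong (λ k → some p k (map row zs)) (length-snoc xs z)) e₂)
    where
    length-snoc : ∀ (xs : List V) z → length (xs ++ z ∷ []) ≡ suc (length xs)
    length-snoc []       z = refl
    length-snoc (x ∷ xs) z = cong suc (length-snoc xs z)

  embeds-sound : ∀ j {n k gs} {xs : Vec V k} → j + k ≡ n → LocatedAll gs xs → Paley adj xs →
                 embeds (map row L) j gs ≡ true → Σ (Vec V n) (Paley adj)
  embeds-sound zero        refl ls ps e = _ , ps
  embeds-sound (suc j) {k = k} eq ls ps e with some-sound _ [] L refl e
  ... | g , x , l , e′ with ∧-true e′
  ... | e₁ , e₂ = embeds-sound j (trans (+-suc j k) eq) (l ∷ ls) (matches-sound residues ls e₁ ∷ ps) e₂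

  module _ (unique : Unique L) (regular : ∀ x → count (adj x) L ≡ 6)
           (codegree : ∀ {x y} → x ≢ y → count (λ z → adj x z ∧ adj y z) L ≡ (if adj x y then 2 else 3)) where

    compatible-rows : ∀ y {xs} → All (_≢ y) xs → compatible (map (adj y) xs) (map row xs) (row y) ≡ true
    compatible-rows y []              = refl
    compatible-rows y {x ∷ xs} (x≢y ∷ ps) rewrite compatible-rows y ps
      | trans (common-map (adj x) (adj y) L) (codegree x≢y) | adj-sym x y
      with adj y x
    ... | true  = refl
    ... | false = refl

    apart : ∀ xs {y : V} {zs} → Unique (xs ++ y ∷ zs) → All (_≢ y) xs
    apart []       _        = []
    apart (x ∷ xs) (p ∷ ps) = middle xs p ∷ apart xs ps
      where
      middle : ∀ {P : V → Set} xs {y zs} → All P (xs ++ y ∷ zs) → P y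
      middle []       (py ∷ _) = py
      middle (_ ∷ xs) (_ ∷ ps) = middle xs ps

    column-row : ∀ xs y zs → L ≡ xs ++ y ∷ zs →
                 map (index (length (map row xs))) (map row xs) ≡ map (adj y) xs
    column-row xs y zs eq rewrite length-map row xs = trans (sym (map-∘ xs)) (map-cong
      (λ x → trans (cong (index (length xs) ∘ map (adj x)) eq) (trans (index-map (adj x) xs y zs) (adj-sym x y))) xs)

    row-split : ∀ xs y zs → L ≡ xs ++ y ∷ zs → row y ≡ map (adj y) xs ++ false ∷ map (adj y) zs
    row-split xs y zs eq = trans (cong (map (adj y)) eq)
      (trans (map-++ (adj y) xs (y ∷ zs)) (cong (λ b → map (adj y) xs ++ b ∷ map (adj y) zs) (adj-irrefl y)))

    -- The rows of the graph itself form one branch of the search: each next row has the prescribed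
    -- beginning, weight and codegrees. Success on all branches therefore includes success on this
    -- one.
    search-sound : ∀ xs zs → L ≡ xs ++ zs → search (length zs) (map row xs) ≡ true →
                   embeds (map row L) 13 [] ≡ true
    search-sound xs [] eq e = trans (cong (λ ys → embeds (map row ys) 13 []) (trans eq (++-identityʳ xs))) e
    search-sound xs (y ∷ zs) eq e
      with ∨-true (every-sound _ (map (adj y) zs) every-tail)
      where
      next : Row → List Row → Row → Bool
      next column rows tail = not (compatible column rows (column ++ false ∷ tail)) ∨
        search (length zs) (rows ++ (column ++ false ∷ tail) ∷ [])
      tail-weight : 6 ∸ weight (map (adj y) xs) ≡ weight (map (adj y) zs)
      tail-weight = begin
        6 ∸ w                                          ≡⟨ cong (_∸ w) (sym (regular y)) ⟩
        weight (row y) ∸ w                             ≡⟨ cong (λ r → weight r ∸ w) (row-split xs y zs eq) ⟩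
        weight (map (adj y) xs ++ false ∷ map (adj y) zs) ∸ w ≡⟨ cong (_∸ w) (weight-++ (map (adj y) xs) _) ⟩
        (w + weight (map (adj y) zs)) ∸ w              ≡⟨ m+n∸m≡n w _ ⟩
        weight (map (adj y) zs)                        ∎
        where
        open ≡-Reasoning
        w = weight (map (adj y) xs)
      every-tail : every (length (map (adj y) zs)) (weight (map (adj y) zs)) (next (map (adj y) xs) (map row xs)) ≡ true
      every-tail = begin
        every (length (map (adj y) zs)) (weight (map (adj y) zs)) (next (map (adj y) xs) (map row xs))
          ≡⟨ cong₂ (λ m w → every m w (next (map (adj y) xs) (map row xs))) (length-map (adj y) zs) (sym tail-weight) ⟩
        every (length zs) (6 ∸ weight (map (adj y) xs)) (next (map (adj y) xs) (map row xs))
          ≡⟨ cong (λ c → every (length zs) (6 ∸ weight c) (next c (map row xs))) (sym (column-row xs y zs eq)) ⟩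
        _ ≡⟨ e ⟩
        true ∎
        where open ≡-Reasoning
    -- The search skips incompatible rows, but the true row of `y` is compatible.
    ... | inj₁ bad = contradiction (trans (sym (cong not ok)) bad) λ ()
      where
      ok : compatible (map (adj y) xs) (map row xs) (map (adj y) xs ++ false ∷ map (adj y) zs) ≡ true
      ok = trans (cong (compatible (map (adj y) xs) (map row xs)) (sym (row-split xs y zs eq)))
                 (compatible-rows y (apart xs (subst Unique eq unique)))
    ... | inj₂ good = search-sound (xs ++ y ∷ []) zs (trans eq (sym (++-assoc xs (y ∷ []) zs)))
      (trans (cong (search (length zs)) (trans (map-++ row xs (y ∷ []))
        (cong (λ r → map row xs ++ r ∷ []) (row-split xs y zs eq)))) good)

-- Strong regularity

adj-complement : ∀ {n} (G : Graph n) {x y} → x ≢ y → adj (complement G) x y ≡ not (adj G x y)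
adj-complement G {x} {y} x≢y with x ≟ y
... | yes x≡y = contradiction x≡y x≢y
... | no  _   = trans (cong (λ b → not (adj G x y) ∨ not b) (adj-sym G y x)) (Bool.∨-idem _)

-- Edges and non-edges are the two colours of a colouring of the complete graph, so that arguments symmetric
-- under complementation are made once.
side : ∀ {n} → Graph n → Bool → Graph n
side G true  = G
side G false = complement G

-- The opposite colour `d` is a variable with an equation, so that the property applies equally with
-- the two colours exchanged.
PathsAvoided : ∀ {n} → Graph n → Set
PathsAvoided {n} G = ∀ c d → d ≡ not c → ∀ {x y z} → x ≢ z →
  adj (side G c) x y ≡ true → adj (side G c) y z ≡ true →
  ∃ λ w → adj (side G d) x w ≡ true × adj (side G d) y w ≡ true × adj (side G d) z w ≡ true

adj-opposite : ∀ {n} (G : Graph n) {c d} → d ≡ not c → ∀ {x y} → x ≢ y → adj (side G d) x y ≡ not (adj (side G c) x y)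
adj-opposite G {true}  refl x≢y = adj-complement G x≢y
adj-opposite G {false} refl {x} {y} x≢y = sym (trans (cong not (adj-complement G x≢y)) (Bool.not-involutive _))

adj⇒≢ : ∀ {n} (G : Graph n) {x y} → adj G x y ≡ true → x ≢ y
adj⇒≢ G {x} e refl = contradiction (trans (sym e) (adj-irrefl G x)) λ ()

Unique-resp-↭ : ∀ {n} {xs ys : List (Fin n)} → xs ↭ ys → Unique xs → Unique ys
Unique-resp-↭ {n} = U ∘ ↭⇒↭ₛ
  where open import Data.List.Relation.Binary.Permutation.Setoid.Properties (setoid (Fin n)) using () renaming (Unique-resp-↭ to U)

-- `near` and `far` are the sets A and B of the double count. Giving them as a reordering of all
-- vertices lets every count over `allFin n` split into three.
record Neighbourhoods {n} (G : Graph n) (v : Fin n) : Set where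
  field
    {near far} : List (Fin n)
    order      : allFin n ↭ v ∷ near ++ far
    adjacent   : All (λ x → adj G v x ≡ true) near
    remote     : All (λ x → adj (complement G) v x ≡ true) far

  covers : ∀ w → w ≡ v ⊎ w ∈ near ⊎ w ∈ far
  covers w with ∈-resp-↭ order (∈-allFin w)
  ... | here w≡v = inj₁ w≡v
  ... | there w∈ = inj₂ (∈-++⁻ near w∈)

  far-not-near : All (λ x → adj G v x ≡ false) far
  far-not-near = All.map (λ {x} p → trans (adj-opposite G {false} refl (adj⇒≢ (complement G) p)) (cong not p)) remote

  count-via : ∀ p → count p (allFin n) ≡ weight (p v ∷ []) + (count p near + count p far)
  count-via p = trans (count-↭ p order) (trans (count-∷ p v _) (cong (weight (p v ∷ []) +_) (count-++ p near far)))

  near-size : count (adj G v) (allFin n) ≡ length near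
  near-size = begin
    count (adj G v) (allFin n)                                ≡⟨ count-via (adj G v) ⟩
    weight (adj G v v ∷ []) + (count (adj G v) near + count (adj G v) far)
      ≡⟨ cong₂ _+_ (cong (λ b → weight (b ∷ [])) (adj-irrefl G v)) (cong₂ _+_ (count-all adjacent) (count-none far-not-near)) ⟩
    length near + 0                                           ≡⟨ +-identityʳ _ ⟩
    length near                                               ∎
    where open ≡-Reasoning

  total : suc (length near + length far) ≡ n
  total = trans (sym (trans (↭-length order) (cong suc (length-++ near)))) (length-tabulate (λ i → i))

neighbourhoods : ∀ {n} (G : Graph n) v → Neighbourhoods G v
neighbourhoods {n} G v with ∈-∃++ (∈-allFin v)
... | as , bs , eq with split (adj G v) (as ++ bs)
... | A , B , split↭ , pA , pB = record
  { order    = order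
  ; adjacent = pA
  ; remote   = All.zipWith (λ (v≢x , p) → trans (adj-complement G v≢x) (cong not p)) (All.++⁻ʳ A apart , pB) }
  where
  order : allFin n ↭ v ∷ A ++ B
  order = ↭-trans (↭-reflexive eq) (↭-trans (shift v as bs) (prep v split↭))
  apart : All (v ≢_) (A ++ B)
  apart with p ∷ _ ← Unique-resp-↭ order (allFin⁺ n) = p

abstract
  third : ∀ (x y : Fin 13) → ∃ λ z → z ≢ x × z ≢ y
  third = from-yes third?
    where
    third? : Dec (∀ (x y : Fin 13) → ∃ λ z → z ≢ x × z ≢ y)
    third? = all? λ x → all? λ y → any? λ z → ¬? (z ≟ x) ×-dec ¬? (z ≟ y)

-- Double counting between neighbours and non-neighbours

module Counting (G : Graph 13) (avoid : PathsAvoided G) where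

  link : Bool → Fin 13 → Fin 13 → Bool
  link c = adj (side G c)

  link-sym : ∀ c {x y b} → link c x y ≡ b → link c y x ≡ b
  link-sym c = trans (adj-sym (side G c) _ _)

  link⇒≢ : ∀ {c x y} → link c x y ≡ true → x ≢ y
  link⇒≢ {c} = adj⇒≢ (side G c)

  exclusive : ∀ {c d} → d ≡ not c → ∀ {v x y} → link c v x ≡ true → link d v y ≡ true → x ≢ y
  exclusive {c} {d} o {v} {x} ec ed refl = contradiction
    (trans (sym ed) (trans (adj-opposite G o (link⇒≢ {c} ec)) (cong not ec))) λ ()

  -- A third vertex `z` linked to `x` or `y` by `c` extends the edge to a path, whose common
  -- neighbour in colour `d` serves. Otherwise `z` is linked to both by `d` and serves itself.
  common₂ : ∀ c d → d ≡ not c → ∀ {x y} → link c x y ≡ true → ∃ λ w → link d x w ≡ true × link d y w ≡ true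
  common₂ c d o {x} {y} xy with third x y
  ... | z , z≢x , z≢y with link c x z in xz | link c y z in yz
  ... | true  | _     with avoid c d o (z≢y) (link-sym c xz) xy
  ... | w , _ , xw , yw = w , xw , yw
  common₂ c d o {x} {y} xy | z , z≢x , z≢y | false | true with avoid c d o (λ x≡z → z≢x (sym x≡z)) xy yz
  ... | w , xw , yw , _ = w , xw , yw
  common₂ c d o {x} {y} xy | z , z≢x , z≢y | false | false =
    z , trans (adj-opposite G o (z≢x ∘ sym)) (cong not xz) , trans (adj-opposite G o (z≢y ∘ sym)) (cong not yz)

  -- w₁ is linked to p by c and to q by not c, and w₂ to both p and q by c and to r by not c;
  -- hence p, q and r are distinct.
  common₃ : ∀ c d → d ≡ not c → c ≡ not d → ∀ {v w} → link c v w ≡ true →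
            3 ≤ count (λ x → link d v x ∧ link d w x) (allFin 13)
  common₃ c d o o′ {v} {w} vw
    -- Paths centred at `v` alternate in colour: `w v w₁` in `c` yields `q`, `p v q` in `d` yields
    -- `w₂`, and `w v w₂` in `c` yields `r`.
    with p  , vp  , wp         ← common₂ c d o vw
    with w₁ , vw₁ , pw₁        ← common₂ d c o′ vp
    with q  , wq  , vq  , w₁q  ← avoid c d o (exclusive o′ (link-sym d wp) pw₁) (link-sym c vw) vw₁
    with w₂ , pw₂ , vw₂ , qw₂  ← avoid d c o′ (exclusive o (link-sym c pw₁) w₁q) (link-sym d vp) vq
    with r  , wr  , vr  , w₂r  ← avoid c d o (exclusive o′ (link-sym d wp) pw₂) (link-sym c vw) vw₂
    = length≤count _ {p ∷ q ∷ r ∷ []}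
        ((exclusive o (link-sym c pw₁) w₁q ∷ exclusive o (link-sym c pw₂) w₂r ∷ []) ∷
         (exclusive o (link-sym c qw₂) w₂r ∷ []) ∷ [] ∷ [])
        (∈-allFin p ∷ ∈-allFin q ∷ ∈-allFin r ∷ [])
        (cong₂ _∧_ vp wp ∷ cong₂ _∧_ vq wq ∷ cong₂ _∧_ vr wr ∷ [])

  module _ {v : Fin 13} (N : Neighbourhoods G v) where
    open Neighbourhoods N

    link-irrefl : ∀ c → link c v v ≡ false
    link-irrefl c = adj-irrefl (side G c) v

    near-not-far : All (λ x → link false v x ≡ false) near
    near-not-far = All.map (λ p → trans (adj-opposite G {true} refl (link⇒≢ {true} p)) (cong not p)) adjacent

    -- Common neighbours of `v` and `x` can only lie in `near`, where the link to `v` is automatic.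
    count-near : ∀ x → count (λ y → link true v y ∧ link true x y) (allFin 13) ≡ count (link true x) near
    count-near x rewrite count-via (λ y → link true v y ∧ link true x y) | link-irrefl true
      | count-none {p = λ y → link true v y ∧ link true x y} (All.map (λ {y} → cong (_∧ link true x y)) far-not-near)
      | count-cong {p = λ y → link true v y ∧ link true x y} {link true x} (All.map (λ {y} → cong (_∧ link true x y)) adjacent) = +-identityʳ _

    count-far : ∀ x → count (λ y → link false v y ∧ link false x y) (allFin 13) ≡ count (link false x) far
    count-far x rewrite count-via (λ y → link false v y ∧ link false x y) | link-irrefl false
      | count-none {p = λ y → link false v y ∧ link false x y} (All.map (λ {y} → cong (_∧ link false x y)) near-not-far)
      | count-cong {p = λ y → link false v y ∧ link false x y} {link false x} (All.map (λ {y} → cong (_∧ link false x y)) remote) = refl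

    far-bound : All (λ w → 3 ≤ count (link true w) near) far
    far-bound = All.map (λ {w} p → subst (3 ≤_) (count-near w) (common₃ false true refl refl p)) remote

    near-bound : All (λ w → 3 ≤ count (link false w) far) near
    near-bound = All.map (λ {w} p → subst (3 ≤_) (count-far w) (common₃ true false refl refl p)) adjacent

    opposite-in-far : ∀ {x} → link true v x ≡ true → All (λ y → link false x y ≡ not (link true x y)) far
    opposite-in-far p = All.map (λ q → adj-opposite G {true} refl (exclusive {true} refl p q)) remote

    -- Every pair between `near` and `far` is either an edge, counted from `far`, or a non-edge,
    -- counted from `near`.
    double-count : ∑ (λ x → count (link true x) near) far + ∑ (λ x → count (link false x) far) near ≡ length near * length far
    double-count = begin
      ∑ (λ x → count (link true x) near) far + S    ≡⟨ cong (_+ S) (∑-count-swap (link true) far near) ⟩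
      ∑ (λ y → count (λ x → link true x y) far) near + S
        ≡⟨ ∑-complementary _ _ (length far) near (All.map (λ {x} p → trans
             (cong (_+ count (link false x) far) (count-cong {p = λ y → link true y x} {link true x} (All.universal (λ y → adj-sym G y x) far)))
             (count-complementary (opposite-in-far p))) adjacent) ⟩
      length near * length far ∎
      where
      open ≡-Reasoning
      S = ∑ (λ x → count (link false x) far) near

    twelve : length near + length far ≡ 12
    twelve = suc-injective total

    -- Two numbers with sum 12 have product at most 36, with equality only for 6 and 6.
    sizes : length near ≡ 6 × length far ≡ 6
    sizes = balanced _ _ twelve (begin
      36                                     ≡⟨ cong (3 *_) (sym twelve) ⟩
      3 * (length near + length far)         ≡⟨ solve 2 (λ a b → con 3 :* (a :+ b) := b :* con 3 :+ a :* con 3) refl (length near) (length far) ⟩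
      length far * 3 + length near * 3       ≤⟨ +-mono-≤ (∑-lower _ far far-bound) (∑-lower _ near near-bound) ⟩
      _                                      ≡⟨ double-count ⟩
      length near * length far               ∎)
      where
      open ≤-Reasoning
      open +-*-Solver
      balanced : ∀ m n → m + n ≡ 12 → 36 ≤ m * n → m ≡ 6 × n ≡ 6
      -- Since `n` is 12 minus `m`, it suffices to check the 13 values of `m`.
      balanced m n m+n≡12 36≤mn with from-yes (all? {n = 13} λ i → (36 ≤? toℕ i * (12 ∸ toℕ i)) →-dec (toℕ i ℕ.≟ 6)) (fromℕ< m<13)
        where
        m<13 : m ℕ.< 13
        m<13 = s≤s (≤-trans (m≤m+n m n) (≤-reflexive m+n≡12))
      ... | f rewrite toℕ-fromℕ< (s≤s (≤-trans (m≤m+n m n) (≤-reflexive m+n≡12)))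
        with refl ← f (subst (λ k → 36 ≤ m * k) (trans (sym (m+n∸m≡n m n)) (cong (_∸ m) m+n≡12)) 36≤mn)
        = refl , +-cancelˡ-≡ 6 n 6 m+n≡12

    degree-six : count (link true v) (allFin 13) ≡ 6
    degree-six = trans near-size (proj₁ sizes)

    -- Edges and non-edges total 36, and each kind numbers at least 6 times 3, that is 18. Hence
    -- neither sum exceeds its lower bound.
    far-exact : All (λ w → count (link true w) near ≡ 3) far
    far-exact = ∑-tight _ far far-bound (+-cancelʳ-≤ 18 _ _ (begin
      ∑ (λ x → count (link true x) near) far + 18  ≡⟨ cong (λ k → ∑ (λ x → count (link true x) near) far + k * 3) (proj₁ sizes) ⟨
      ∑ (λ x → count (link true x) near) far + length near * 3 ≤⟨ +-monoʳ-≤ _ (∑-lower _ near near-bound) ⟩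
      ∑ (λ x → count (link true x) near) far + ∑ (λ x → count (link false x) far) near ≡⟨ double-count ⟩
      length near * length far ≡⟨ cong₂ _*_ (proj₁ sizes) (proj₂ sizes) ⟩
      36 ≡⟨ cong (λ k → k * 3 + 18) (proj₂ sizes) ⟨
      length far * 3 + 18 ∎))
      where
      open ≤-Reasoning

    near-exact : All (λ w → count (link false w) far ≡ 3) near
    near-exact = ∑-tight _ near near-bound (+-cancelˡ-≤ 18 _ _ (begin
      18 + ∑ (λ x → count (link false x) far) near  ≡⟨ cong (λ k → k * 3 + ∑ (λ x → count (link false x) far) near) (proj₂ sizes) ⟨
      length far * 3 + ∑ (λ x → count (link false x) far) near ≤⟨ +-mono-≤ (∑-lower _ far far-bound) ≤-refl ⟩
      ∑ (λ x → count (link true x) near) far + ∑ (λ x → count (link false x) far) near ≡⟨ double-count ⟩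
      length near * length far ≡⟨ cong₂ _*_ (proj₁ sizes) (proj₂ sizes) ⟩
      36 ≡⟨ cong (λ k → 18 + k * 3) (proj₁ sizes) ⟨
      18 + length near * 3 ∎))
      where open ≤-Reasoning

  -- For `w` in `far` this is `far-exact`. A vertex `w` in `near` has degree 6, with one link to `v`
  -- and three into `far`, where it misses three of six vertices; two links into `near` remain.
  codegree-from : ∀ {v w} → Neighbourhoods G v → v ≢ w →
                  count (λ x → link true v x ∧ link true w x) (allFin 13) ≡ (if link true v w then 2 else 3)
  codegree-from {v} {w} N v≢w with Neighbourhoods.covers N w
  ... | inj₁ w≡v = contradiction (sym w≡v) v≢w
  ... | inj₂ (inj₂ w∈far) rewrite All.lookup (Neighbourhoods.far-not-near N) w∈far =
    trans (count-near N w) (All.lookup (far-exact N) w∈far)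
  ... | inj₂ (inj₁ w∈near) rewrite All.lookup (Neighbourhoods.adjacent N) w∈near =
    trans (count-near N w) (+-cancelʳ-≡ 4 _ 2 (begin
      count (link true w) near + 4                          ≡⟨ +-comm _ 4 ⟩
      1 + (3 + count (link true w) near)                    ≡⟨ cong suc (+-comm 3 (count (link true w) near)) ⟩
      1 + (count (link true w) near + 3)                    ≡⟨ cong (λ k → 1 + (count (link true w) near + k)) far-count ⟨
      1 + (count (link true w) near + count (link true w) far) ≡⟨ cong (λ b → weight (b ∷ []) + (count (link true w) near + count (link true w) far)) (link-sym true wv) ⟨
      weight (link true w v ∷ []) + (count (link true w) near + count (link true w) far) ≡⟨ count-via (link true w) ⟨
      count (link true w) (allFin 13)                       ≡⟨ degree-six (neighbourhoods G w) ⟩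
      6                                                  ∎))
    where
    open ≡-Reasoning
    open Neighbourhoods N
    wv : link true v w ≡ true
    wv = All.lookup adjacent w∈near
    far-count : count (link true w) far ≡ 3
    far-count = +-cancelʳ-≡ 3 _ 3 (trans (cong (count (link true w) far +_) (sym (All.lookup (near-exact N) w∈near)))
      (trans (count-complementary (opposite-in-far N wv)) (proj₂ (sizes N))))

  regular : ∀ v → count (link true v) (allFin 13) ≡ 6
  regular v = degree-six (neighbourhoods G v)

  codegree : ∀ {v w} → v ≢ w → count (λ x → link true v x ∧ link true w x) (allFin 13) ≡ (if link true v w then 2 else 3)
  codegree = codegree-from (neighbourhoods G _)

-- Uniqueness of the strongly regular graph with parameters (13,6,2,3)

-- If `y` were missed, punching it out would inject `Fin (suc n)` into `Fin n`.
injective⇒surjective : ∀ {n} {f : Fin n → Fin n} → Injective _≡_ _≡_ f → ∀ y → ∃ λ x → f x ≡ y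
injective⇒surjective {suc n} {f} inj y with any? (λ x → f x ≟ y)
... | yes found = found
... | no missed = contradiction
  (λ {i} {j} eq → inj (punchOut-injective (λ e → missed (i , sym e)) (λ e → missed (j , sym e)) eq))
  (<⇒notInjective {f = λ i → punchOut {i = y} {j = f i} (λ e → missed (i , sym e))} (n<1+n n))

-- Both indices are lowered until one is zero, so only their distance is looked up. Its sign does
-- not matter because -1 is a residue modulo 13.
circulant : ∀ {n} → Fin n → Fin n → Bool
circulant zero    zero    = false
circulant zero    (suc j) = index (toℕ j) residues
circulant (suc i) zero    = index (toℕ i) residues
circulant (suc i) (suc j) = circulant i j

abstract
  QR13-circulant : ∀ i j → adj QR13 i j ≡ circulant i j
  QR13-circulant = from-yes check
    where
    check : Dec (∀ i j → adj QR13 i j ≡ circulant i j)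
    check = all? λ i → all? λ j → adj QR13 i j Bool.≟ circulant i j

  -- Distinct vertices of QR13 have distinct neighbourhoods. This is what makes the entries of a
  -- `Paley` vector of length 13 distinct.
  circulant-separates : ∀ (i j : Fin 13) → (∀ k → circulant i k ≡ circulant j k) → i ≡ j
  circulant-separates = from-yes check
    where
    check : Dec (∀ (i j : Fin 13) → (∀ k → circulant i k ≡ circulant j k) → i ≡ j)
    check = all? λ i → all? λ j → (all? λ k → circulant i k Bool.≟ circulant j k) →-dec (i ≟ j)

map-replicate : ∀ {A : Set} {p : A → Bool} {b xs} → All (λ x → p x ≡ b) xs → map p xs ≡ replicate (length xs) b
map-replicate []       = refl
map-replicate (e ∷ es) = cong₂ _∷_ e (map-replicate es)

module _ (G : Graph 13) where

  Paley-adj : ∀ {k} {xs : Vec (Fin 13) k} → Paley (adj G) xs → ∀ i j → adj G (Vec.lookup xs i) (Vec.lookup xs j) ≡ circulant i j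
  Paley-adj (_∷_ {x = x} p ps) zero zero    = adj-irrefl G x
  Paley-adj (p ∷ ps) zero    (suc j) = p j
  Paley-adj (p ∷ ps) (suc i) zero    = trans (adj-sym G _ _) (p i)
  Paley-adj (p ∷ ps) (suc i) (suc j) = Paley-adj ps i j

  Paley⇒≅ : Σ (Vec (Fin 13) 13) (Paley (adj G)) → G ≅ QR13
  Paley⇒≅ (xs , ps) = mk↔ₛ′ from to from-to to-from , λ x y → begin
    adj G x y                           ≡⟨ cong₂ (adj G) (to-from x) (to-from y) ⟨
    adj G (to (from x)) (to (from y))   ≡⟨ Paley-adj ps (from x) (from y) ⟩
    circulant (from x) (from y)         ≡⟨ QR13-circulant (from x) (from y) ⟨
    adj QR13 (from x) (from y)          ∎
    where
    open ≡-Reasoning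
    to from : Fin 13 → Fin 13
    to = Vec.lookup xs
    to-injective : Injective _≡_ _≡_ to
    to-injective {i} {j} eq = circulant-separates i j λ k →
      trans (sym (Paley-adj ps i k)) (trans (cong (λ x → adj G x (to k)) eq) (Paley-adj ps j k))
    from x = proj₁ (injective⇒surjective to-injective x)
    to-from : ∀ x → to (from x) ≡ x
    to-from x = proj₂ (injective⇒surjective to-injective x)
    from-to : ∀ i → from (to i) ≡ i
    from-to i = to-injective (to-from (to i))

module _ (G : Graph 13)
         (regular : ∀ v → count (adj G v) (allFin 13) ≡ 6)
         (codegree : ∀ {v w} → v ≢ w → count (λ x → adj G v x ∧ adj G w x) (allFin 13) ≡ (if adj G v w then 2 else 3)) where

  -- In this order of the vertices, the rows of `v` and `a` are `first-row` and `second-row`, from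
  -- which the search starts.
  ordered⇒≅ : ∀ {v a A₁ A₂ B₁ B₂} → allFin 13 ↭ v ∷ a ∷ (A₁ ++ A₂) ++ (B₁ ++ B₂) →
    length A₁ ≡ 2 → length A₂ ≡ 3 → length B₁ ≡ 3 → length B₂ ≡ 3 →
    All (λ x → adj G v x ≡ true) (a ∷ A₁ ++ A₂) → All (λ x → adj G v x ≡ false) (B₁ ++ B₂) →
    All (λ x → adj G a x ≡ true) A₁ → All (λ x → adj G a x ≡ false) A₂ →
    All (λ x → adj G a x ≡ true) B₁ → All (λ x → adj G a x ≡ false) B₂ → G ≅ QR13
  ordered⇒≅ {v} {a} {A₁} {A₂} {B₁} {B₂} order lA₁ lA₂ lB₁ lB₂ (va ∷ vA) vB aA₁ aA₂ aB₁ aB₂ =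
    Paley⇒≅ G (embeds-sound 13 refl [] [] (search-sound
      (Unique-resp-↭ order (allFin⁺ 13))
      (λ x → trans (sym (count-↭ (adj G x) order)) (regular x))
      (λ {x} {y} x≢y → trans (sym (count-↭ (λ z → adj G x z ∧ adj G y z) order)) (codegree x≢y))
      (v ∷ a ∷ []) ((A₁ ++ A₂) ++ (B₁ ++ B₂)) refl
      (trans (cong₂ search length-rest (cong₂ (λ r s → r ∷ s ∷ []) row-v row-a)) search-succeeds)))
    where
    open Order (adj G) (adj-sym G) (adj-irrefl G) (v ∷ a ∷ (A₁ ++ A₂) ++ (B₁ ++ B₂))
    blocks : ∀ {x b₁ b₂ b₃ b₄} →
      All (λ y → adj G x y ≡ b₁) A₁ → All (λ y → adj G x y ≡ b₂) A₂ →
      All (λ y → adj G x y ≡ b₃) B₁ → All (λ y → adj G x y ≡ b₄) B₂ →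
      map (adj G x) ((A₁ ++ A₂) ++ (B₁ ++ B₂)) ≡
      (replicate 2 b₁ ++ replicate 3 b₂) ++ (replicate 3 b₃ ++ replicate 3 b₄)
    blocks {x} {b₁} {b₂} {b₃} {b₄} p₁ p₂ p₃ p₄ =
      trans (map-++ (adj G x) (A₁ ++ A₂) (B₁ ++ B₂)) (cong₂ _++_
        (trans (map-++ (adj G x) A₁ A₂) (cong₂ _++_ (block p₁ lA₁) (block p₂ lA₂)))
        (trans (map-++ (adj G x) B₁ B₂) (cong₂ _++_ (block p₃ lB₁) (block p₄ lB₂))))
      where
      block : ∀ {b k xs} → All (λ y → adj G x y ≡ b) xs → length xs ≡ k → map (adj G x) xs ≡ replicate k b
      block ps refl = map-replicate ps
    length-rest : length ((A₁ ++ A₂) ++ (B₁ ++ B₂)) ≡ 11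
    length-rest = trans (length-++ (A₁ ++ A₂)) (cong₂ _+_
      (trans (length-++ A₁) (cong₂ _+_ lA₁ lA₂)) (trans (length-++ B₁) (cong₂ _+_ lB₁ lB₂)))
    row-v : row v ≡ first-row
    row-v = cong₂ _∷_ (adj-irrefl G v) (cong₂ _∷_ va
      (blocks (All.++⁻ˡ A₁ vA) (All.++⁻ʳ A₁ vA) (All.++⁻ˡ B₁ vB) (All.++⁻ʳ B₁ vB)))
    row-a : row a ≡ second-row
    row-a = cong₂ _∷_ (trans (adj-sym G a v) va) (cong₂ _∷_ (adj-irrefl G a) (blocks aA₁ aA₂ aB₁ aB₂))

module _ (G : Graph 13) (avoid : PathsAvoided G) where
  open Counting G avoid

  -- Any neighbour `a` of `v` will do. It has two neighbours in `near` by the codegree and, beside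
  -- `v` and these two, three more in `far`; this fixes the sizes of the four blocks.
  ordered : ∀ {v} → Neighbourhoods G v → G ≅ QR13
  ordered N@record { near = [] } = contradiction (proj₁ (sizes N)) λ ()
  ordered {v} N@record { near = a ∷ near′ ; far = far ; order = order ; adjacent = va ∷ near-adj } =
    let A₁ , A₂ , ↭A , aA₁ , aA₂ = split (adj G a) near′
        B₁ , B₂ , ↭B , aB₁ , aB₂ = split (adj G a) far
        A₁-size = trans (sym (part-size ↭A aA₁ aA₂)) near-count
        B₁-size = trans (sym (part-size ↭B aB₁ aB₂)) far-count
    in ordered⇒≅ G regular codegree
      (↭-trans order (prep v (prep a (++⁺ ↭A ↭B))))
      A₁-size (rest-size 2 A₁ ↭A A₁-size (suc-injective (proj₁ (sizes N))))
      B₁-size (rest-size 3 B₁ ↭B B₁-size (proj₂ (sizes N)))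
      (va ∷ All-resp-↭ ↭A near-adj) (All-resp-↭ ↭B (Neighbourhoods.far-not-near N))
      aA₁ aA₂ aB₁ aB₂
    where
    open ≡-Reasoning
    rest-size : ∀ k {xs} ys {zs : List (Fin 13)} {m} → xs ↭ ys ++ zs → length ys ≡ k → length xs ≡ k + m → length zs ≡ m
    rest-size k {xs} ys {zs} {m} xs↭ ys-size xs-size = +-cancelˡ-≡ k _ m (begin
      k + length zs         ≡⟨ cong (_+ length zs) ys-size ⟨
      length ys + length zs ≡⟨ length-++ ys ⟨
      length (ys ++ zs)     ≡⟨ ↭-length xs↭ ⟨
      length xs             ≡⟨ xs-size ⟩
      k + m                 ∎)
    part-size : ∀ {xs ys zs} → xs ↭ ys ++ zs → All (λ x → adj G a x ≡ true) ys →
                All (λ x → adj G a x ≡ false) zs → count (adj G a) xs ≡ length ys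
    part-size {xs} {ys} {zs} xs↭ pys pzs = begin
      count (adj G a) xs                         ≡⟨ count-↭ (adj G a) xs↭ ⟩
      count (adj G a) (ys ++ zs)                 ≡⟨ count-++ (adj G a) ys zs ⟩
      count (adj G a) ys + count (adj G a) zs    ≡⟨ cong₂ _+_ (count-all pys) (count-none pzs) ⟩
      length ys + 0                              ≡⟨ +-identityʳ _ ⟩
      length ys                                  ∎
    all-near-count : count (adj G a) (a ∷ near′) ≡ count (adj G a) near′
    all-near-count = trans (count-∷ (adj G a) a near′) (cong (λ b → weight (b ∷ []) + count (adj G a) near′) (adj-irrefl G a))
    near-count : count (adj G a) near′ ≡ 2
    near-count = begin
      count (adj G a) near′                            ≡⟨ all-near-count ⟨
      count (adj G a) (a ∷ near′)                      ≡⟨ count-near N a ⟨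
      count (λ x → adj G v x ∧ adj G a x) (allFin 13)  ≡⟨ codegree (adj⇒≢ G va) ⟩
      (if adj G v a then 2 else 3)                     ≡⟨ cong (if_then 2 else 3) va ⟩
      2                                                ∎
    far-count : count (adj G a) far ≡ 3
    far-count = +-cancelˡ-≡ 3 _ 3 (begin
      1 + (2 + count (adj G a) far)
        ≡⟨ cong (λ k → 1 + (k + count (adj G a) far)) (trans all-near-count near-count) ⟨
      1 + (count (adj G a) (a ∷ near′) + count (adj G a) far)
        ≡⟨ cong (λ b → weight (b ∷ []) + (count (adj G a) (a ∷ near′) + count (adj G a) far)) (trans (adj-sym G a v) va) ⟨
      weight (adj G a v ∷ []) + (count (adj G a) (a ∷ near′) + count (adj G a) far) ≡⟨ Neighbourhoods.count-via N (adj G a) ⟨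
      count (adj G a) (allFin 13)                      ≡⟨ regular a ⟩
      6                                                ∎)

avoiding⇒≅ : (G : Graph 13) → PathsAvoided G → G ≅ QR13
avoiding⇒≅ G avoid = ordered G avoid (neighbourhoods G zero)

-- Contracting a dominating path

==-true : ∀ {n} {x y : Fin n} → (x == y) ≡ true → x ≡ y
==-true {x = x} {y} e with x ≟ y
... | yes x≡y = x≡y

==-refl : ∀ {n} (x : Fin n) → (x == x) ≡ true
==-refl x with x ≟ x
... | yes _ = refl
... | no x≢x = contradiction refl x≢x

mkGraph-adj : ∀ {n} (r : Fin n → Fin n → Bool) {x y} → x ≢ y → r x y ≡ true → adj (mkGraph r) x y ≡ true
mkGraph-adj r {x} {y} x≢y rxy with x ≟ y
... | yes x≡y = contradiction x≡y x≢y
... | no _ rewrite rxy = refl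

mkGraph-adj⁻ : ∀ {n} (r : Fin n → Fin n → Bool) {x y} → adj (mkGraph r) x y ≡ true → r x y ≡ true ⊎ r y x ≡ true
mkGraph-adj⁻ r {x} {y} e = ∨-true (proj₂ (∧-true {not (x == y)} {r x y ∨ r y x} e))

contracted : ∀ {n} → Graph (suc n) → Fin (suc n) → Fin n → Fin n → Fin n → Bool
contracted G v u x y = adj G (punchIn v x) (punchIn v y) ∨ (x == u ∧ adj G v (punchIn v y))

contract-adj : ∀ {n} (G : Graph (suc n)) v u {x y} → x ≢ y → adj G (punchIn v x) (punchIn v y) ≡ true →
               adj (contractEdge G v u) x y ≡ true
contract-adj G v u {x} {y} x≢y e =
  mkGraph-adj (contracted G v u) x≢y (cong (_∨ (x == u ∧ adj G v (punchIn v y))) e)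

contract-adj-merged : ∀ {n} (G : Graph (suc n)) v u {y} → u ≢ y → adj G v (punchIn v y) ≡ true →
                      adj (contractEdge G v u) u y ≡ true
contract-adj-merged G v u {y} u≢y e = mkGraph-adj (contracted G v u) u≢y
  (trans (cong₂ (λ a b → adj G (punchIn v u) (punchIn v y) ∨ (a ∧ b)) (==-refl u) e) (Bool.∨-zeroʳ _))

length-filter : ∀ {A : Set} (p : A → Bool) xs → length (filter (λ x → p x Bool.≟ true) xs) ≡ count p xs
length-filter p []       = refl
length-filter p (x ∷ xs) with p x
... | true  = cong suc (length-filter p xs)
... | false = length-filter p xs

degree-universal : ∀ {n} (G : Graph (suc n)) x → (∀ y → x ≢ y → adj G x y ≡ true) → n ≤ degree G x
degree-universal {n} G x all = ≤-trans
  (≤-reflexive (sym (trans (length-map (punchIn x) (allFin n)) (length-tabulate (λ i → i)))))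
  (≤-trans
    (length≤count (adj G x) {map (punchIn x) (allFin n)} {allFin (suc n)}
      (map⁺ (punchIn-injective x _ _) (allFin⁺ n))
      (All.universal (λ y → ∈-allFin y) _)
      (All.map⁺ (All.universal (λ y → all _ (punchInᵢ≢i x y ∘ sym)) (allFin n))))
    (≤-reflexive (sym (length-filter (adj G x) (allFin (suc n))))))

degree≤maxDegree : ∀ {n} (G : Graph n) x → degree G x ≤ maxDegree G
degree≤maxDegree G x = below (∈-allFin x)
  where
  below : ∀ {xs} → x ∈ xs → degree G x ≤ foldr _⊔_ 0 (map (degree G) xs)
  below (here refl) = m≤m⊔n _ _
  below (there x∈)  = ≤-trans (below x∈) (m≤n⊔m _ _)

-- Contracting `x` into `y`, and then `z` into the merged vertex, makes that vertex adjacent to all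
-- `n` others.
dominating-path : ∀ {n} (G : Graph (3 + n)) {x y z} → x ≢ z → adj G x y ≡ true → adj G y z ≡ true →
  (∀ w → w ≢ x → w ≢ y → w ≢ z → adj G x w ≡ true ⊎ adj G y w ≡ true ⊎ adj G z w ≡ true) →
  Σ[ H ∈ Graph (suc n) ] H ≼ G × n ≤ maxDegree H
dominating-path {n} G {x} {y} {z} x≢z xy yz dominated =
  G₂ , ≼-contr x y₁ (trans (cong (adj G x) in-y₁) xy) (≼-contr z₁ y₂ (trans (cong (adj G₁ z₁) in-y₂) z₁y₁) ≼-refl) ,
  ≤-trans (degree-universal G₂ y₂ universal) (degree≤maxDegree G₂ y₂)
  where
  x≢y = adj⇒≢ G xy
  -- Subscript 1 marks names after the removal of `x`; `y₂` is the merged vertex after the removal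
  -- of `z₁` as well.
  y₁ = punchOut x≢y
  z₁ = punchOut x≢z
  in-y₁ : punchIn x y₁ ≡ y
  in-y₁ = punchIn-punchOut x≢y
  in-z₁ : punchIn x z₁ ≡ z
  in-z₁ = punchIn-punchOut x≢z
  z₁≢y₁ : z₁ ≢ y₁
  z₁≢y₁ e = adj⇒≢ G yz (trans (sym in-y₁) (trans (cong (punchIn x) (sym e)) in-z₁))
  G₁ = contractEdge G x y₁
  z₁y₁ : adj G₁ z₁ y₁ ≡ true
  z₁y₁ = contract-adj G x y₁ z₁≢y₁ (trans (cong₂ (adj G) in-z₁ in-y₁) (trans (adj-sym G z y) yz))
  y₂ = punchOut z₁≢y₁
  in-y₂ : punchIn z₁ y₂ ≡ y₁
  in-y₂ = punchIn-punchOut z₁≢y₁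
  G₂ = contractEdge G₁ z₁ y₂
  universal : ∀ w → y₂ ≢ w → adj G₂ y₂ w ≡ true
  universal w y₂≢w with dominated (punchIn x (punchIn z₁ w)) (punchInᵢ≢i x _)
    (λ e → y₂≢w (punchIn-injective z₁ _ _ (trans in-y₂ (sym (punchIn-injective x _ _ (trans e (sym in-y₁)))))))
    (λ e → punchInᵢ≢i z₁ w (punchIn-injective x _ _ (trans e (sym in-z₁))))
  ... | inj₁ xw = contract-adj G₁ z₁ y₂ y₂≢w (trans (cong (λ a → adj G₁ a (punchIn z₁ w)) in-y₂)
    (contract-adj-merged G x y₁ (λ e → y₂≢w (punchIn-injective z₁ _ _ (trans in-y₂ e))) xw))
  ... | inj₂ (inj₁ yw) = contract-adj G₁ z₁ y₂ y₂≢w (trans (cong (λ a → adj G₁ a (punchIn z₁ w)) in-y₂)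
    (contract-adj G x y₁ (λ e → y₂≢w (punchIn-injective z₁ _ _ (trans in-y₂ e)))
      (trans (cong (λ a → adj G a (punchIn x (punchIn z₁ w))) in-y₁) yw)))
  ... | inj₂ (inj₂ zw) = contract-adj-merged G₁ z₁ y₂ y₂≢w (contract-adj G x y₁ (punchInᵢ≢i z₁ w ∘ sym)
      (trans (cong (λ a → adj G a (punchIn x (punchIn z₁ w))) in-z₁) zw))

-- If no vertex is linked to the whole path by `d`, then the path dominates in colour `c`, and
-- contracting it gives a minor on 11 vertices with a vertex of degree 10.
noncompliant⇒avoiding : (G : Graph 13) → NonCompliant 3 G → PathsAvoided G
noncompliant⇒avoiding G noncompliant c d d≡¬c {x} {y} {z} x≢z xy yz with any? (λ w →
  (adj (side G d) x w Bool.≟ true) ×-dec (adj (side G d) y w Bool.≟ true) ×-dec (adj (side G d) z w Bool.≟ true))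
... | yes found = found
... | no none = contradiction (compliant c (dominating-path (side G c) x≢z xy yz dominated)) noncompliant
  where
  compliant : ∀ c → (Σ[ H ∈ Graph 11 ] H ≼ side G c × 10 ≤ maxDegree H) → Compliant 3 G
  compliant true  (H , H≼ , large) = 11 , H , inj₁ H≼ , large
  compliant false (H , H≼ , large) = 11 , H , inj₂ H≼ , large
  dominated : ∀ w → w ≢ x → w ≢ y → w ≢ z →
    adj (side G c) x w ≡ true ⊎ adj (side G c) y w ≡ true ⊎ adj (side G c) z w ≡ true
  dominated w w≢x w≢y w≢z with adj (side G c) x w in xw | adj (side G c) y w in yw | adj (side G c) z w in zw
  ... | true  | _     | _     = inj₁ refl
  ... | false | true  | _     = inj₂ (inj₁ refl)
  ... | false | false | true  = inj₂ (inj₂ refl)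
  ... | false | false | false = contradiction (w , flip w≢x xw , flip w≢y yw , flip w≢z zw) none
    where
    flip : ∀ {v} → w ≢ v → adj (side G c) v w ≡ false → adj (side G d) v w ≡ true
    flip w≢v vw = trans (adj-opposite G d≡¬c (w≢v ∘ sym)) (cong not vw)

-- Minors containing a vertex of large degree

-- Connected vertex sets, listed without repetition so that the length is the cardinality.
data Cluster {n} (G : Graph n) : List (Fin n) → Set where
  root : ∀ x → Cluster G (x ∷ [])
  grow : ∀ {x y S} → Cluster G S → y ∉ S → x ∈ S → adj G x y ≡ true → Cluster G (y ∷ S)

-- The trace in G of a vertex of degree at least k in a minor of G: core is its branch set, and extra contains
-- the vertices that the core does not dominate.
record Hub (k : ℕ) {n} (G : Graph n) : Set where
  constructor hub
  field
    {core extra} : List (Fin n)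
    cluster      : Cluster G core
    small        : length core + length extra + k ≤ n
    dominated    : ∀ w → w ∈ core ⊎ w ∈ extra ⊎ ∃ λ s → s ∈ core × adj G s w ≡ true

-- Vertices outside the image of `f` join `extra`, and `enough` pays for them in `small`. This
-- serves vertex deletion, edge deletion and isomorphisms.
Hub-map : ∀ {k m n} {H : Graph m} {G : Graph n} (f : Fin m → Fin n) → Injective _≡_ _≡_ f →
          (∀ {x y} → adj H x y ≡ true → adj G (f x) (f y) ≡ true) →
          ∀ missed → length missed + m ≤ n → (∀ w → w ∈ missed ⊎ ∃ λ x → w ≡ f x) → Hub k H → Hub k G
Hub-map {k} {m} {n} {H} {G} f injective preserves missed enough cover (hub {core} {extra} cluster small dominated) =
  hub (cluster-map cluster) small′ dominated′
  where
  cluster-map : ∀ {S} → Cluster H S → Cluster G (map f S)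
  cluster-map (root x) = root (f x)
  cluster-map (grow {y = y} c y∉ x∈ xy) = grow (cluster-map c) fresh (∈-map⁺ f x∈) (preserves xy)
    where
    fresh : f y ∉ map f _
    fresh fy∈ with z , z∈ , e ← ∈-map⁻ f fy∈ with refl ← injective e = y∉ z∈
  small′ : length (map f core) + length (missed ++ map f extra) + k ≤ n
  small′ = begin
    length (map f core) + length (missed ++ map f extra) + k
      ≡⟨ cong₂ (λ a b → a + b + k) (length-map f core) (trans (length-++ missed) (cong (length missed +_) (length-map f extra))) ⟩
    length core + (length missed + length extra) + k
      ≡⟨ solve 4 (λ c m e k → c :+ (m :+ e) :+ k := m :+ (c :+ e :+ k)) refl (length core) (length missed) (length extra) k ⟩
    length missed + (length core + length extra + k) ≤⟨ +-monoʳ-≤ (length missed) small ⟩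
    length missed + m ≤⟨ enough ⟩
    n ∎
    where
    open ≤-Reasoning
    open +-*-Solver
  dominated′ : ∀ w → w ∈ map f core ⊎ w ∈ missed ++ map f extra ⊎ ∃ λ s → s ∈ map f core × adj G s w ≡ true
  dominated′ w with cover w
  ... | inj₁ w∈ = inj₂ (inj₁ (∈-++⁺ˡ w∈))
  ... | inj₂ (x , refl) with dominated x
  ... | inj₁ x∈ = inj₁ (∈-map⁺ f x∈)
  ... | inj₂ (inj₁ x∈) = inj₂ (inj₁ (∈-++⁺ʳ missed (∈-map⁺ f x∈)))
  ... | inj₂ (inj₂ (s , s∈ , sx)) = inj₂ (inj₂ (f s , ∈-map⁺ f s∈ , preserves sx))

punchIn-cover : ∀ {n} (v w : Fin (suc n)) → w ≡ v ⊎ ∃ λ x → w ≡ punchIn v x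
punchIn-cover v w with v ≟ w
... | yes v≡w = inj₁ (sym v≡w)
... | no  v≢w = inj₂ (punchOut v≢w , sym (punchIn-punchOut v≢w))

contract-adj⁻ : ∀ {n} (G : Graph (suc n)) v u {x y} → adj (contractEdge G v u) x y ≡ true →
  adj G (punchIn v x) (punchIn v y) ≡ true ⊎ (x ≡ u × adj G v (punchIn v y) ≡ true) ⊎ (y ≡ u × adj G (punchIn v x) v ≡ true)
contract-adj⁻ G v u {x} {y} e with mkGraph-adj⁻ (contracted G v u) {x} {y} e
... | inj₁ e₁ with ∨-true {adj G (punchIn v x) (punchIn v y)} e₁
... | inj₁ xy = inj₁ xy
... | inj₂ m with p , q ← ∧-true {x == u} m = inj₂ (inj₁ (==-true p , q))
contract-adj⁻ G v u {x} {y} e | inj₂ e₂ with ∨-true {adj G (punchIn v y) (punchIn v x)} e₂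
... | inj₁ yx = inj₁ (trans (adj-sym G _ _) yx)
... | inj₂ m with p , q ← ∧-true {y == u} m = inj₂ (inj₂ (==-true p , trans (adj-sym G _ _) q))

module _ {n} (G : Graph (suc n)) (v : Fin (suc n)) (u : Fin n) (vu : adj G v (punchIn v u) ≡ true) where

  private
    ι : Fin n → Fin (suc n)
    ι = punchIn v
    ι-injective : ∀ {x y} → ι x ≡ ι y → x ≡ y
    ι-injective = punchIn-injective v _ _
    v≢ι : ∀ {x} → v ≢ ι x
    v≢ι {x} e = punchInᵢ≢i v x (sym e)

  -- The branch set in `G` that contracts to `S`; it absorbs `v` exactly when `S` contains the
  -- merged vertex `u`.
  record Lift (S : List (Fin n)) : Set where
    constructor lift
    field
      {preimage} : List (Fin (suc n))
      cluster    : Cluster G preimage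
      whole      : ∀ {x} → x ∈ S → ι x ∈ preimage
      only       : ∀ {x} → ι x ∈ preimage → x ∈ S
      size       : (u ∈ S × v ∈ preimage × length preimage ≡ suc (length S)) ⊎
                   (u ∉ S × v ∉ preimage × length preimage ≡ length S)

  -- When the merged vertex is added, the end of `vu` that the connecting edge reaches is added
  -- first, and the other end follows along `vu`.
  Cluster-lift : ∀ {S} → Cluster (contractEdge G v u) S → Lift S
  Cluster-lift (root x) with x ≟ u
  ... | yes refl = lift (grow (root (ι u)) (λ { (here e) → v≢ι e }) (here refl) (trans (adj-sym G _ _) vu))
          (λ { (here refl) → there (here refl) })
          (λ { (here e) → contradiction (sym e) v≢ι ; (there (here e)) → here (ι-injective e) })
          (inj₁ (here refl , here refl , refl))
  ... | no x≢u = lift (root (ι x)) (λ { (here refl) → here refl }) (λ { (here e) → here (ι-injective e) })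
          (inj₂ ((λ { (here e) → x≢u (sym e) }) , (λ { (here e) → v≢ι e }) , refl))
  Cluster-lift (grow {x} {y} {S} c y∉ x∈ xy) with Cluster-lift c | y ≟ u | contract-adj⁻ G v u xy
  ... | lift {P} c′ whole only size | no y≢u | edge = lift (attach edge)
          (λ { (here refl) → here refl ; (there z∈) → there (whole z∈) })
          (λ { (here e) → here (ι-injective e) ; (there z∈) → there (only z∈) })
          (Sum.map (λ (u∈ , v∈ , e) → there u∈ , there v∈ , cong suc e)
                   (λ (u∉ , v∉ , e) → (λ { (here e) → y≢u (sym e) ; (there u∈) → u∉ u∈ }) ,
                                      (λ { (here e) → v≢ι e ; (there v∈) → v∉ v∈ }) , cong suc e) size)
    where
    fresh : ι y ∉ P
    fresh = y∉ ∘ only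
    absorbed : u ∈ S → v ∈ P
    absorbed u∈ = Sum.[ (λ (_ , v∈ , _) → v∈) , (λ (u∉ , _) → contradiction u∈ u∉) ] size
    attach : _ → Cluster G (ι y ∷ P)
    attach (inj₁ xy)               = grow c′ fresh (whole x∈) xy
    attach (inj₂ (inj₁ (refl , vy))) = grow c′ fresh (absorbed x∈) vy
    attach (inj₂ (inj₂ (y≡u , _))) = contradiction y≡u y≢u
  ... | lift c′ whole only (inj₁ (u∈ , _)) | yes refl | _ = contradiction u∈ y∉
  ... | lift c′ whole only (inj₂ (u∉ , v∉ , e)) | yes refl | inj₁ xu =
          lift (grow (grow c′ (y∉ ∘ only) (whole x∈) xu) (λ { (here e) → v≢ι e ; (there v∈) → v∉ v∈ })
                     (here refl) (trans (adj-sym G _ _) vu))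
            (λ { (here refl) → there (here refl) ; (there z∈) → there (there (whole z∈)) })
            (λ { (here e) → contradiction (sym e) v≢ι ; (there (here e)) → here (ι-injective e) ; (there (there z∈)) → there (only z∈) })
            (inj₁ (here refl , here refl , cong (2 +_) e))
  ... | lift c′ whole only (inj₂ (u∉ , v∉ , e)) | yes refl | inj₂ (inj₁ (refl , _)) = contradiction x∈ u∉
  ... | lift c′ whole only (inj₂ (u∉ , v∉ , e)) | yes refl | inj₂ (inj₂ (_ , xv)) =
          lift (grow (grow c′ v∉ (whole x∈) xv) (λ { (here e) → v≢ι (sym e) ; (there u∈) → y∉ (only u∈) })
                     (here refl) vu)
            (λ { (here refl) → here refl ; (there z∈) → there (there (whole z∈)) })
            (λ { (here e) → here (ι-injective e) ; (there (here e)) → contradiction (sym e) v≢ι ; (there (there z∈)) → there (only z∈) })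
            (inj₁ (here refl , there (here refl) , cong (2 +_) e))

  -- Undoing the contraction adds one vertex: to the core if the merged vertex lies there, and to
  -- `extra` otherwise. Either way `small` persists.
  Hub-contract : ∀ {k} → Hub k (contractEdge G v u) → Hub k G
  Hub-contract {k} (hub {core} {extra} c small dominated) with Cluster-lift c
  ... | lift {P} c′ whole only (inj₁ (u∈ , v∈ , size)) = hub {extra = map ι extra} c′ small′ dominated′
    where
    small′ : length P + length (map ι extra) + k ≤ suc n
    small′ rewrite size | length-map ι extra = s≤s small
    dominated′ : ∀ w → w ∈ P ⊎ w ∈ map ι extra ⊎ ∃ λ s → s ∈ P × adj G s w ≡ true
    dominated′ w with punchIn-cover v w
    ... | inj₁ refl = inj₁ v∈
    ... | inj₂ (x , refl) with dominated x
    ... | inj₁ x∈ = inj₁ (whole x∈)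
    ... | inj₂ (inj₁ x∈) = inj₂ (inj₁ (∈-map⁺ ι x∈))
    ... | inj₂ (inj₂ (s , s∈ , sx)) with contract-adj⁻ G v u sx
    ... | inj₁ sx′ = inj₂ (inj₂ (ι s , whole s∈ , sx′))
    ... | inj₂ (inj₁ (_ , vx)) = inj₂ (inj₂ (v , v∈ , vx))
    ... | inj₂ (inj₂ (refl , _)) = inj₁ (whole u∈)
  ... | lift {P} c′ whole only (inj₂ (u∉ , v∉ , size)) with split-u
    where
    -- One end of the contracted edge inherits the domination of u, the other joins the extra vertices.
    split-u : ∃ λ spare → ∀ w → w ≡ v ⊎ w ≡ ι u → w ∈ spare ∷ map ι extra ⊎ ∃ λ s → s ∈ P × adj G s w ≡ true
    split-u with dominated u
    ... | inj₁ u∈ = contradiction u∈ u∉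
    ... | inj₂ (inj₁ u∈) = v , λ { _ (inj₁ refl) → inj₁ (here refl) ; _ (inj₂ refl) → inj₁ (there (∈-map⁺ ι u∈)) }
    ... | inj₂ (inj₂ (s , s∈ , su)) with contract-adj⁻ G v u su
    ... | inj₁ su′ = v , λ { _ (inj₁ refl) → inj₁ (here refl) ; _ (inj₂ refl) → inj₂ (ι s , whole s∈ , su′) }
    ... | inj₂ (inj₁ (refl , _)) = contradiction s∈ u∉
    ... | inj₂ (inj₂ (_ , sv)) = ι u , λ { _ (inj₂ refl) → inj₁ (here refl) ; _ (inj₁ refl) → inj₂ (ι s , whole s∈ , sv) }
  ... | spare , ends = hub {extra = spare ∷ map ι extra} c′ small′ dominated′
    where
    small′ : length P + suc (length (map ι extra)) + k ≤ suc n
    small′ rewrite size | length-map ι extra | +-suc (length core) (length extra) = s≤s small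
    dominated′ : ∀ w → w ∈ P ⊎ w ∈ spare ∷ map ι extra ⊎ ∃ λ s → s ∈ P × adj G s w ≡ true
    dominated′ w with punchIn-cover v w
    ... | inj₁ w≡v = inj₂ (ends w (inj₁ w≡v))
    ... | inj₂ (x , refl) with x ≟ u
    ... | yes refl = inj₂ (ends w (inj₂ refl))
    ... | no x≢u with dominated x
    ... | inj₁ x∈ = inj₁ (whole x∈)
    ... | inj₂ (inj₁ x∈) = inj₂ (inj₁ (there (∈-map⁺ ι x∈)))
    ... | inj₂ (inj₂ (s , s∈ , sx)) with contract-adj⁻ G v u sx
    ... | inj₁ sx′ = inj₂ (inj₂ (ι s , whole s∈ , sx′))
    ... | inj₂ (inj₁ (refl , _)) = contradiction s∈ u∉
    ... | inj₂ (inj₂ (x≡u , _)) = contradiction x≡u x≢u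

Hub-minor : ∀ {k m n} {H : Graph m} {G : Graph n} → H ≼ G → Hub k H → Hub k G
Hub-minor ≼-refl h = h
Hub-minor {G = G} (≼-delV v H≼) h = Hub-map (punchIn v) (punchIn-injective v _ _) preserves (v ∷ []) ≤-refl
  (λ w → Sum.map here (λ p → p) (punchIn-cover v w)) (Hub-minor H≼ h)
  where
  preserves : ∀ {x y} → adj (deleteVertex G v) x y ≡ true → adj G (punchIn v x) (punchIn v y) ≡ true
  preserves {x} {y} e = Sum.[ (λ p → p) , trans (adj-sym G _ _) ]
    (mkGraph-adj⁻ (λ x y → adj G (punchIn v x) (punchIn v y)) {x} {y} e)
Hub-minor {n = n} {G = G} (≼-delE u v _ H≼) h = Hub-map (λ x → x) (λ e → e) preserves [] ≤-refl (λ w → inj₂ (w , refl)) (Hub-minor H≼ h)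
  where
  kept : Fin n → Fin n → Bool
  kept x y = adj G x y ∧ not ((x == u ∧ y == v) ∨ (x == v ∧ y == u))
  preserves : ∀ {x y} → adj (deleteEdge G u v) x y ≡ true → adj G x y ≡ true
  keep : ∀ {x y} → kept x y ≡ true → adj G x y ≡ true
  keep {x} {y} e = proj₁ (∧-true {adj G x y} e)
  preserves {x} {y} e = Sum.[ keep , trans (adj-sym G x y) ∘ keep ] (mkGraph-adj⁻ kept {x} {y} e)
Hub-minor {G = G} (≼-contr v u vu H≼) h = Hub-contract G v u vu (Hub-minor H≼ h)

-- A positive bound excludes the default value 0 of the fold.
maxDegree-attained : ∀ {n k} (G : Graph n) → suc k ≤ maxDegree G → ∃ λ x → suc k ≤ degree G x
maxDegree-attained {n} {k} G = attained (allFin n)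
  where
  attained : ∀ xs → suc k ≤ foldr _⊔_ 0 (map (degree G) xs) → ∃ λ x → suc k ≤ degree G x
  attained (x ∷ xs) le with ⊔-sel (degree G x) (foldr _⊔_ 0 (map (degree G) xs))
  ... | inj₁ e = x , subst (suc k ≤_) e le
  ... | inj₂ e = attained xs (subst (suc k ≤_) e le)

-- The core is `x` alone and `extra` consists of its non-neighbours.
degree⇒Hub : ∀ {n k} (G : Graph n) x → k ≤ degree G x → Hub k G
degree⇒Hub {n} {k} G x k≤ = hub (root x) small dominated
  where
  open Neighbourhoods (neighbourhoods G x)
  small : suc (length far + k) ≤ n
  small = begin
    suc (length far + k)           ≤⟨ s≤s (+-monoʳ-≤ (length far) k≤) ⟩
    suc (length far + degree G x)  ≡⟨ cong (λ d → suc (length far + d)) (trans (length-filter (adj G x) (allFin n)) near-size) ⟩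
    suc (length far + length near) ≡⟨ cong suc (+-comm (length far) (length near)) ⟩
    suc (length near + length far) ≡⟨ total ⟩
    n                              ∎
    where open ≤-Reasoning
  dominated : ∀ w → w ∈ x ∷ [] ⊎ w ∈ far ⊎ ∃ λ s → s ∈ x ∷ [] × adj G s w ≡ true
  dominated w with covers w
  ... | inj₁ w≡x        = inj₁ (here w≡x)
  ... | inj₂ (inj₁ w∈)  = inj₂ (inj₂ (x , here refl , All.lookup adjacent w∈))
  ... | inj₂ (inj₂ w∈)  = inj₂ (inj₁ w∈)

-- Exclusion of hubs in QR13

Undominated : List (Fin 13) → List (Fin 13) → Set
Undominated core extra = ∃ λ w → All (λ s → w ≢ s × circulant s w ≡ false) core × All (w ≢_) extra

undominated? : ∀ core extra → Dec (Undominated core extra)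
undominated? core extra = any? λ w →
  All.all? (λ s → ¬? (w ≟ s) ×-dec circulant s w Bool.≟ false) core ×-dec All.all? (λ s → ¬? (w ≟ s)) extra

abstract
  -- A vertex dominates 7 of the 13 vertices, itself included, so at least four remain outside two
  -- extra ones.
  undominated₁ : ∀ x a b → Undominated (x ∷ []) (a ∷ b ∷ [])
  undominated₁ = from-yes check
    where
    check : Dec (∀ x a b → Undominated (x ∷ []) (a ∷ b ∷ []))
    check = all? λ x → all? λ a → all? λ b → undominated? _ _

  -- Adjacent vertices have codegree 2 and so dominate 6 + 6 - 2 = 10 vertices; one extra vertex
  -- cannot cover the other three.
  undominated₂ : ∀ x y a → circulant x y ≡ true → Undominated (x ∷ y ∷ []) (a ∷ [])
  undominated₂ = from-yes check
    where
    check : Dec (∀ x y a → circulant x y ≡ true → Undominated (x ∷ y ∷ []) (a ∷ []))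
    check = all? λ x → all? λ y → all? λ a → (circulant x y Bool.≟ true) →-dec undominated? _ _

  undominated₃ : ∀ x y z → circulant x y ≡ true → circulant y z ≡ true → Undominated (x ∷ y ∷ z ∷ []) []
  undominated₃ = from-yes check
    where
    check : Dec (∀ x y z → circulant x y ≡ true → circulant y z ≡ true → Undominated (x ∷ y ∷ z ∷ []) [])
    check = all? λ x → all? λ y → all? λ z →
      (circulant x y Bool.≟ true) →-dec (circulant y z Bool.≟ true) →-dec undominated? _ _

-- Core and `extra` have at most 13 - 10 = 3 vertices together, so the core is a vertex, an edge or
-- a path on three vertices.
QR13-hubless : ¬ Hub 10 QR13
QR13-hubless (hub {core} {extra} cluster small dominated) = cases cluster (+-cancelʳ-≤ 10 _ 3 small) refute
  where
  refute : ∀ {C E} → core ⊆ C → extra ⊆ E → ¬ Undominated C E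
  refute core⊆ extra⊆ (w , missed , outside) with dominated w
  ... | inj₁ w∈ = proj₁ (All.lookup missed (core⊆ w∈)) refl
  ... | inj₂ (inj₁ w∈) = All.lookup outside (extra⊆ w∈) refl
  ... | inj₂ (inj₂ (s , s∈ , sw)) = contradiction
    (trans (sym sw) (trans (QR13-circulant s w) (proj₂ (All.lookup missed (core⊆ s∈))))) λ ()
  edge : ∀ x y → adj QR13 x y ≡ true → circulant x y ≡ true
  edge x y = trans (sym (QR13-circulant x y))
  edgeᵒ : ∀ x y → adj QR13 y x ≡ true → circulant x y ≡ true
  edgeᵒ x y = edge x y ∘ trans (adj-sym QR13 x y)
  cases : ∀ {core extra} → Cluster QR13 core → length core + length extra ≤ 3 →
          (∀ {C E} → core ⊆ C → extra ⊆ E → ¬ Undominated C E) → ⊥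
  -- Missing extra vertices are padded by repeating known ones; `refute` accepts supersets of `core`
  -- and `extra`.
  cases {extra = []}            (root x) _ refuted = refuted (λ p → p) (λ ()) (undominated₁ x x x)
  cases {extra = a ∷ []}        (root x) _ refuted = refuted (λ p → p) (λ { (here e) → here e }) (undominated₁ x a a)
  cases {extra = a ∷ b ∷ []}    (root x) _ refuted = refuted (λ p → p) (λ p → p) (undominated₁ x a b)
  cases {extra = _ ∷ _ ∷ _ ∷ _} (root x) (s≤s (s≤s (s≤s ())))
  cases {extra = []}            (grow {y = y} (root x) _ (here refl) xy) _ refuted =
    refuted (λ p → p) (λ ()) (undominated₂ y x x (edgeᵒ y x xy))
  cases {extra = a ∷ []}        (grow {y = y} (root x) _ (here refl) xy) _ refuted =
    refuted (λ p → p) (λ p → p) (undominated₂ y x a (edgeᵒ y x xy))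
  cases {extra = _ ∷ _ ∷ _}     (grow (root x) _ _ _) (s≤s (s≤s (s≤s ())))
  cases {extra = []}            (grow {y = z} (grow {y = y} (root x) _ (here refl) xy) _ (here refl) yz) _ refuted =
    refuted (λ p → p) (λ ()) (undominated₃ z y x (edgeᵒ z y yz) (edgeᵒ y x xy))
  -- Here `x` is the middle of the path, so the core is reordered as `z`, `x`, `y`.
  cases {extra = []}            (grow {y = z} (grow {y = y} (root x) _ (here refl) xy) _ (there (here refl)) xz) _ refuted =
    refuted (λ { (here e) → here e ; (there (here e)) → there (there (here e)) ; (there (there (here e))) → there (here e) })
      (λ ()) (undominated₃ z x y (edgeᵒ z x xz) (edge x y xy))
  cases {extra = _ ∷ _}         (grow (grow (root x) _ _ _) _ _ _) (s≤s (s≤s (s≤s ())))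
  cases (grow (grow (grow {S = _ ∷ _} _ _ _ _) _ _ _) _ _ _) (s≤s (s≤s (s≤s ())))

-- Isomorphism, complementation and the conclusion

Hub-≅ : ∀ {k n} (G H : Graph n) → G ≅ H → Hub k G → Hub k H
Hub-≅ G H (f , preserves) = Hub-map to to-injective (λ {x} {y} e → trans (sym (preserves x y)) e)
  [] ≤-refl (λ w → inj₂ (from w , sym (strictlyInverseˡ w)))
  where
  open Inverse f
  to-injective : Injective _≡_ _≡_ to
  to-injective {x} {y} e = trans (sym (strictlyInverseʳ x)) (trans (cong from e) (strictlyInverseʳ y))

complement-≅ : ∀ {n} (G H : Graph n) → G ≅ H → complement G ≅ complement H
complement-≅ G H (f , preserves) = f , preserves′
  where
  open Inverse f
  preserves′ : ∀ x y → adj (complement G) x y ≡ adj (complement H) (to x) (to y)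
  preserves′ x y = compare (x ≟ y)
    where
    compare : Dec (x ≡ y) → adj (complement G) x y ≡ adj (complement H) (to x) (to y)
    compare (yes refl) = trans (adj-irrefl (complement G) x) (sym (adj-irrefl (complement H) (to x)))
    compare (no x≢y) = trans (adj-complement G x≢y) (trans (cong not (preserves x y)) (sym (adj-complement H
      (λ e → x≢y (trans (sym (strictlyInverseʳ x)) (trans (cong from e) (strictlyInverseʳ y)))))))

-- Multiplication by the non-residue 2, whose inverse is 7, exchanges residues and non-residues.
abstract
  QR13-self-complementary : complement QR13 ≅ QR13
  QR13-self-complementary = mk↔ₛ′ (scale 2) (scale 7) (from-yes inverseˡ) (from-yes inverseʳ) , from-yes preserves
    where
    scale : ℕ → Fin 13 → Fin 13
    scale k x = (k * toℕ x) mod 13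
    inverseˡ : Dec (∀ x → scale 2 (scale 7 x) ≡ x)
    inverseˡ = all? λ x → scale 2 (scale 7 x) ≟ x
    inverseʳ : Dec (∀ x → scale 7 (scale 2 x) ≡ x)
    inverseʳ = all? λ x → scale 7 (scale 2 x) ≟ x
    preserves : Dec (∀ x y → adj (complement QR13) x y ≡ adj QR13 (scale 2 x) (scale 2 y))
    preserves = all? λ x → all? λ y → adj (complement QR13) x y Bool.≟ adj QR13 (scale 2 x) (scale 2 y)

-- A vertex of degree 10 in the minor is a hub there. It is pulled back to `G` or its complement and
-- then carried to QR13, in the second case through self-complementarity.
QR13⇒noncompliant : (G : Graph 13) → G ≅ QR13 → NonCompliant 3 G
QR13⇒noncompliant G iso (m , H , minor , large) with maxDegree-attained H large
... | x , large-x with degree⇒Hub H x large-x | minor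
... | h | inj₁ H≼G  = QR13-hubless (Hub-≅ G QR13 iso (Hub-minor H≼G h))
... | h | inj₂ H≼Gᶜ = QR13-hubless (Hub-≅ (complement QR13) QR13 QR13-self-complementary
  (Hub-≅ (complement G) (complement QR13) (complement-≅ G QR13 iso) (Hub-minor H≼Gᶜ h)))

theorem6 : (G : Graph 13) → (NonCompliant 3 G → G ≅ QR13) × (G ≅ QR13 → NonCompliant 3 G)
theorem6 G = (λ noncompliant → avoiding⇒≅ G (noncompliant⇒avoiding G noncompliant)) , QR13⇒noncompliant G
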